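{- If $Sp(K,S)$ is a split graph with biadjacency matrix $R$ and $\operatorname{Supp}(Sp)\cap K\ne\varnothing$, then \[\operatorname{nl}(Sp)=\operatorname{nl}(R)+1.\]
   Context: Graphs are finite and simple. A split graph is a graph $Sp$ whose vertex set is a disjoint union of a clique $K$ and an independent set $S$; the pair $(K,S)$ is called an s-partition, and $Sp(K,S)$ denotes $Sp$ together with this s-partition. Both $K$ and $S$ are assumed nonempty. With the vertices ordered as $(K,S)$, the adjacency matrix is \[A(Sp)=\begin{pmatrix} J-I & R\\ R^t & 0\end{pmatrix},\] where $J$ is an all-ones matrix, $I$ the identity, and $R$ is the $|K|\times|S|$ $0/1$ biadjacency matrix ($R_{uv}=1$ iff $u\in K$ and $v\in S$ are adjacent). $\operatorname{nl}(A)$ is the dimension of the nullspace of a real matrix $A$ and $\operatorname{nl}(Sp)=\operatorname{nl}(A(Sp))$. $\operatorname{Supp}(Sp)$ is the set of vertices $v$ such that $x_v\ne 0$ for some $x$ in the nullspace of $A(Sp)$. -}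

module Defs where

open import Algebra.Bundles using (CommutativeRing)
import Algebra.Properties.Ring as RingProperties
import Algebra.Properties.Semiring.Sum as SemiringSum
open import Data.Bool using (if_then_else_)
open import Data.Fin using (Fin; zero; suc; punchIn; _↑ˡ_; _↑ʳ_; _≟_)
open import Data.Fin.Properties using (any?; punchInᵢ≢i)
open import Data.Nat as ℕ using (ℕ; zero; suc; NonZero)
open import Data.Product using (Σ; ∃; ∃-syntax; _×_; _,_; proj₁; proj₂)
open import Data.Vec.Functional using (Vector; head; tail; insertAt)
open import Data.Vec.Functional.Properties using (insertAt-lookup; insertAt-punchIn)
open import Function using (_∘_)
open import Level using (Level; _⊔_; 0ℓ) renaming (suc to lsuc)
open import Relation.Binary using (Rel; Decidable; Symmetric; Irreflexive; IsStrictTotalOrder)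
open import Relation.Binary.PropositionalEquality as ≡ using (_≡_; _≢_)
import Relation.Binary.Reasoning.Setoid as SetoidReasoning
open import Relation.Nullary using (¬_; yes; no; contradiction)
open import Relation.Nullary.Decidable using (does; ¬?; decidable-stable)
open import Relation.Unary using (Pred)

-- The library has no real numbers, so linear algebra is done over an arbitrary
-- ordered field (with the usual trichotomous order).  Classically ℝ is one;
-- completeness is not assumed.
record OrderedField (c ℓ₁ ℓ₂ : Level) : Set (lsuc (c ⊔ ℓ₁ ⊔ ℓ₂)) where
  field
    commutativeRing : CommutativeRing c ℓ₁
  open CommutativeRing commutativeRing public
    renaming (_+_ to infixl 6 _+_; _*_ to infixl 7 _*_; -_ to infix 8 -_; _≈_ to infix 4 _≈_)
  infix 4 _<_
  field
    _<_                : Rel Carrier ℓ₂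
    isStrictTotalOrder : IsStrictTotalOrder _≈_ _<_
    0≉1                : ¬ 0# ≈ 1#
    inverse            : ∀ x → ¬ x ≈ 0# → ∃[ y ] x * y ≈ 1#
    +-monoˡ-<          : ∀ {x y} z → x < y → x + z < y + z
    *-pos              : ∀ {x y} → 0# < x → 0# < y → 0# < x * y

Matrix : ∀ {c ℓ₁ ℓ₂} → OrderedField c ℓ₁ ℓ₂ → ℕ → ℕ → Set c
Matrix F m n = Vector (Vector (OrderedField.Carrier F) n) m

module LinearAlgebra {c ℓ₁ ℓ₂} (F : OrderedField c ℓ₁ ℓ₂) where
  open OrderedField F hiding (zero)
  open SemiringSum semiring
  open RingProperties ring
  open SetoidReasoning setoid

  dot : ∀ {n} → Vector Carrier n → Vector Carrier n → Carrier
  dot {n} φ x = ∑[ j < n ] (φ j * x j)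

  Nullspace : ∀ {m n} → Matrix F m n → Pred (Vector Carrier n) ℓ₁
  Nullspace M x = ∀ i → dot (M i) x ≈ 0#

  lincomb : ∀ {d n} → Vector Carrier d → Vector (Vector Carrier n) d → Vector Carrier n
  lincomb {d} a b j = ∑[ i < d ] (a i * b i j)

  record IsBasis {d n} (V : Pred (Vector Carrier n) ℓ₁)
                 (b : Vector (Vector Carrier n) d) : Set (c ⊔ ℓ₁) where
    field
      members     : ∀ i → V (b i)
      independent : ∀ a → (∀ j → lincomb a b j ≈ 0#) → ∀ i → a i ≈ 0#
      spanning    : ∀ x → V x → ∃[ a ] (∀ j → lincomb a b j ≈ x j)

  HasDimension : ∀ {n} → Pred (Vector Carrier n) ℓ₁ → ℕ → Set (c ⊔ ℓ₁)
  HasDimension {n} V d = Σ (Vector (Vector Carrier n) d) (IsBasis V)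

  private
    δ : ∀ {n} → Fin n → Fin n → Carrier
    δ i j = if does (i ≟ j) then 1# else 0#

    δ-diag : ∀ {n} (i : Fin n) → δ i i ≈ 1#
    δ-diag i with i ≟ i
    ... | yes _  = refl
    ... | no i≢i = contradiction ≡.refl i≢i

    δ-off : ∀ {n} {i j : Fin n} → i ≢ j → δ i j ≈ 0#
    δ-off {i = i} {j} i≢j with i ≟ j
    ... | yes i≡j = contradiction i≡j i≢j
    ... | no _    = refl

    sum-zero : ∀ {n} (f : Vector Carrier n) → (∀ i → f i ≈ 0#) → sum f ≈ 0#
    sum-zero {n} f f≈0 = trans (sum-cong-≋ f≈0) (sum-replicate-zero n)

    lincomb-δ : ∀ {n} (a : Vector Carrier n) j → lincomb a δ j ≈ a j
    lincomb-δ {suc n} a j = begin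
      lincomb a δ j
        ≈⟨ sum-remove {i = j} (λ i → a i * δ i j) ⟩
      a j * δ j j + ∑[ k < n ] (a (punchIn j k) * δ (punchIn j k) j)
        ≈⟨ +-cong (trans (*-congˡ (δ-diag j)) (*-identityʳ _))
                  (sum-zero _ λ k → trans (*-congˡ (δ-off (punchInᵢ≢i j k))) (zeroʳ _)) ⟩
      a j + 0#
        ≈⟨ +-identityʳ _ ⟩
      a j ∎

    x∙yz≈y∙xz : ∀ x y z → x * (y * z) ≈ y * (x * z)
    x∙yz≈y∙xz x y z = begin
      x * (y * z) ≈⟨ *-assoc x y z ⟨
      x * y * z   ≈⟨ *-congʳ (*-comm x y) ⟩
      y * x * z   ≈⟨ *-assoc y x z ⟩
      y * (x * z) ∎

    dot-cong : ∀ {n} (φ : Vector Carrier n) {x y} → (∀ j → x j ≈ y j) → dot φ x ≈ dot φ y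
    dot-cong φ x≈y = sum-cong-≋ (λ j → *-congˡ (x≈y j))

    dot-linear : ∀ {n} (φ x y : Vector Carrier n) t →
                 dot φ (λ j → x j + t * y j) ≈ dot φ x + t * dot φ y
    dot-linear {n} φ x y t = begin
      ∑[ j < n ] (φ j * (x j + t * y j))
        ≈⟨ sum-cong-≋ {n} (λ j → trans (distribˡ _ _ _) (+-congˡ (x∙yz≈y∙xz _ _ _))) ⟩
      ∑[ j < n ] (φ j * x j + t * (φ j * y j))
        ≈⟨ ∑-distrib-+ (λ j → φ j * x j) _ ⟩
      dot φ x + ∑[ j < n ] (t * (φ j * y j))
        ≈⟨ +-congˡ (*-distribˡ-sum t (λ j → φ j * y j)) ⟨
      dot φ x + t * dot φ y ∎

    dot-lincomb : ∀ {d n} (φ : Vector Carrier n) a (b : Vector (Vector Carrier n) d) →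
                  dot φ (lincomb a b) ≈ ∑[ i < d ] (a i * dot φ (b i))
    dot-lincomb {d} {n} φ a b = begin
      ∑[ j < n ] (φ j * ∑[ i < d ] (a i * b i j))
        ≈⟨ sum-cong-≋ (λ j → *-distribˡ-sum (φ j) (λ i → a i * b i j)) ⟩
      ∑[ j < n ] ∑[ i < d ] (φ j * (a i * b i j))
        ≈⟨ ∑-comm (λ j i → φ j * (a i * b i j)) ⟩
      ∑[ i < d ] ∑[ j < n ] (φ j * (a i * b i j))
        ≈⟨ sum-cong-≋ (λ i → trans (sum-cong-≋ (λ j → x∙yz≈y∙xz (φ j) (a i) (b i j)))
                                   (sym (*-distribˡ-sum (a i) (λ j → φ j * b i j)))) ⟩
      ∑[ i < d ] (a i * dot φ (b i)) ∎

    -- Elimination at the pivot p: from a basis b of the common kernel of the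
    -- remaining rows, with φ(b p) invertible, drop b p and correct the others.
    module Pivot {d m n} (M : Matrix F (suc m) n)
                 (b : Vector (Vector Carrier n) (suc d)) (isB : IsBasis (Nullspace (tail M)) b)
                 (p : Fin (suc d)) (q : Carrier) (pq≈1 : dot (head M) (b p) * q ≈ 1#) where
      open IsBasis isB

      φ = head M

      α : Vector Carrier (suc d)
      α i = dot φ (b i)

      t : Vector Carrier d
      t k = - (α (punchIn p k) * q)

      b′ : Vector (Vector Carrier n) d
      b′ k j = b (punchIn p k) j + t k * b p j

      members′ : ∀ k → Nullspace M (b′ k)
      members′ k zero = begin
        dot φ (b′ k)                              ≈⟨ dot-linear φ (b (punchIn p k)) (b p) (t k) ⟩
        α (punchIn p k) + t k * α p               ≈⟨ +-congˡ (-‿distribˡ-* _ _) ⟨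
        α (punchIn p k) + - (α (punchIn p k) * q * α p)
          ≈⟨ +-congˡ (-‿cong (trans (*-assoc _ _ _) (trans (*-congˡ (trans (*-comm q _) pq≈1)) (*-identityʳ _)))) ⟩
        α (punchIn p k) + - α (punchIn p k)       ≈⟨ -‿inverseʳ _ ⟩
        0# ∎
      members′ k (suc i) = begin
        dot (M (suc i)) (b′ k)
          ≈⟨ dot-linear (M (suc i)) (b (punchIn p k)) (b p) (t k) ⟩
        dot (M (suc i)) (b (punchIn p k)) + t k * dot (M (suc i)) (b p)
          ≈⟨ +-cong (members (punchIn p k) i) (trans (*-congˡ (members p i)) (zeroʳ _)) ⟩
        0# + 0#
          ≈⟨ +-identityʳ 0# ⟩
        0# ∎

      extend : ∀ (a′ : Vector Carrier (suc d)) (a : Vector Carrier d) →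
               (∀ k → a′ (punchIn p k) ≈ a k) → a′ p ≈ ∑[ k < d ] (a k * t k) →
               ∀ j → lincomb a′ b j ≈ lincomb a b′ j
      extend a′ a a′≈a a′p j = begin
        lincomb a′ b j
          ≈⟨ sum-remove {i = p} (λ i → a′ i * b i j) ⟩
        a′ p * b p j + ∑[ k < d ] (a′ (punchIn p k) * b (punchIn p k) j)
          ≈⟨ +-comm _ _ ⟩
        ∑[ k < d ] (a′ (punchIn p k) * b (punchIn p k) j) + a′ p * b p j
          ≈⟨ +-cong (sum-cong-≋ (λ k → *-congʳ (a′≈a k)))
                    (trans (*-congʳ a′p) (*-distribʳ-sum (b p j) (λ k → a k * t k))) ⟩
        ∑[ k < d ] (a k * b (punchIn p k) j) + ∑[ k < d ] (a k * t k * b p j)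
          ≈⟨ ∑-distrib-+ (λ k → a k * b (punchIn p k) j) _ ⟨
        ∑[ k < d ] (a k * b (punchIn p k) j + a k * t k * b p j)
          ≈⟨ sum-cong-≋ {d} (λ k → trans (+-congˡ (*-assoc _ _ _)) (sym (distribˡ _ _ _))) ⟩
        lincomb a b′ j ∎

      independent′ : ∀ a → (∀ j → lincomb a b′ j ≈ 0#) → ∀ k → a k ≈ 0#
      independent′ a a·b′≈0 k =
        trans (reflexive (≡.sym (insertAt-punchIn a p s k)))
              (independent a⁺ (λ j → trans (extend a⁺ a
                 (λ k → reflexive (insertAt-punchIn a p s k))
                 (reflexive (insertAt-lookup a p s)) j) (a·b′≈0 j)) (punchIn p k))
        where
        s  = ∑[ k < d ] (a k * t k)
        a⁺ = insertAt a p s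

      spanning′ : ∀ x → Nullspace M x → ∃[ a ] (∀ j → lincomb a b′ j ≈ x j)
      spanning′ x Mx≈0 with spanning x (Mx≈0 ∘ suc)
      ... | a , a·b≈x = a ∘ punchIn p , λ j →
              trans (sym (extend a (a ∘ punchIn p) (λ _ → refl) aₚ j)) (a·b≈x j)
        where
        rest = ∑[ k < d ] (a (punchIn p k) * α (punchIn p k))

        a·α≈0 : a p * α p + rest ≈ 0#
        a·α≈0 = begin
          a p * α p + rest                ≈⟨ sum-remove {i = p} (λ i → a i * α i) ⟨
          ∑[ i < suc d ] (a i * α i)      ≈⟨ dot-lincomb φ a b ⟨
          dot φ (lincomb a b)             ≈⟨ dot-cong φ a·b≈x ⟩
          dot φ x                         ≈⟨ Mx≈0 zero ⟩
          0# ∎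

        aₚ : a p ≈ ∑[ k < d ] (a (punchIn p k) * t k)
        aₚ = begin
          a p                   ≈⟨ *-identityʳ _ ⟨
          a p * 1#              ≈⟨ *-congˡ pq≈1 ⟨
          a p * (α p * q)       ≈⟨ *-assoc _ _ _ ⟨
          a p * α p * q         ≈⟨ *-congʳ (+-inverseˡ-unique _ _ a·α≈0) ⟩
          - rest * q            ≈⟨ -‿distribˡ-* _ _ ⟨
          - (rest * q)          ≈⟨ -‿distribʳ-* _ _ ⟩
          rest * - q            ≈⟨ *-distribʳ-sum (- q) (λ k → a (punchIn p k) * α (punchIn p k)) ⟩
          ∑[ k < d ] (a (punchIn p k) * α (punchIn p k) * - q)
            ≈⟨ sum-cong-≋ {d} (λ k → trans (*-assoc _ _ _) (*-congˡ (sym (-‿distribʳ-* _ _)))) ⟩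
          ∑[ k < d ] (a (punchIn p k) * t k) ∎

      isBasis : IsBasis (Nullspace M) b′
      isBasis = record { members = members′ ; independent = independent′ ; spanning = spanning′ }

  -- A basis is computed by eliminating one row at a time.
  nullspace-dimension : ∀ {m n} (M : Matrix F m n) → ∃ (HasDimension (Nullspace M))
  nullspace-dimension {zero} {n} M = n , δ , record
    { members     = λ _ ()
    ; independent = λ a a·δ≈0 i → trans (sym (lincomb-δ a i)) (a·δ≈0 i)
    ; spanning    = λ x _ → x , lincomb-δ x
    }
  nullspace-dimension {suc m} M with nullspace-dimension (tail M)
  ... | d , b , isB with any? (λ i → ¬? (IsStrictTotalOrder._≟_ isStrictTotalOrder (dot (head M) (b i)) 0#))
  ...   | no ¬∃ = d , b , record
    { members     = λ i → λ
      { zero    → decidable-stable (IsStrictTotalOrder._≟_ isStrictTotalOrder _ _) (λ ≉0 → ¬∃ (i , ≉0))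
      ; (suc r) → IsBasis.members isB i r }
    ; independent = IsBasis.independent isB
    ; spanning    = λ x Mx≈0 → IsBasis.spanning isB x (Mx≈0 ∘ suc)
    }
  nullspace-dimension {suc m} M | suc d , b , isB | yes (p , α≉0) =
    d , Pivot.b′ M b isB p (proj₁ q) (proj₂ q) , Pivot.isBasis M b isB p (proj₁ q) (proj₂ q)
    where q = inverse _ α≉0

module _ {c ℓ₁ ℓ₂} (F : OrderedField c ℓ₁ ℓ₂) where
  open OrderedField F using (_≈_; 0#)
  open LinearAlgebra F

  nl : ∀ {m n} → Matrix F m n → ℕ
  nl M = proj₁ (nullspace-dimension M)

  Supp : ∀ {m n} → Matrix F m n → Pred (Fin n) (c ⊔ ℓ₁)
  Supp M v = ∃[ x ] Nullspace M x × ¬ x v ≈ 0#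

record Graph (n : ℕ) : Set₁ where
  infix 4 _~_ _~?_
  field
    _~_    : Rel (Fin n) 0ℓ
    _~?_   : Decidable _~_
    ~-sym  : Symmetric _~_
    ~-irr  : Irreflexive _≡_ _~_

IsClique : ∀ {n} → Graph n → Pred (Fin n) 0ℓ → Set
IsClique G P = ∀ {u v} → P u → P v → u ≢ v → u ~ v
  where open Graph G

IsIndependent : ∀ {n} → Graph n → Pred (Fin n) 0ℓ → Set
IsIndependent G P = ∀ {u v} → P u → P v → ¬ u ~ v
  where open Graph G

-- Vertices are ordered as (K , S): the first k form K, the last s form S.
K-part S-part : ∀ k s → Pred (Fin (k ℕ.+ s)) 0ℓ
K-part k s v = ∃[ i ] v ≡ i ↑ˡ s
S-part k s v = ∃[ j ] v ≡ k ↑ʳ j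

record SplitGraph (k s : ℕ) : Set₁ where
  field
    graph         : Graph (k ℕ.+ s)
    K-nonempty    : NonZero k
    S-nonempty    : NonZero s
    K-clique      : IsClique graph (K-part k s)
    S-independent : IsIndependent graph (S-part k s)

  K S : Pred (Fin (k ℕ.+ s)) 0ℓ
  K = K-part k s
  S = S-part k s

module _ {c ℓ₁ ℓ₂} (F : OrderedField c ℓ₁ ℓ₂) where
  open OrderedField F using (0#; 1#)

  adjacencyMatrix : ∀ {n} → Graph n → Matrix F n n
  adjacencyMatrix G u v = if does (u ~? v) then 1# else 0#
    where open Graph G

  A : ∀ {k s} → SplitGraph k s → Matrix F (k ℕ.+ s) (k ℕ.+ s)
  A Sp = adjacencyMatrix (SplitGraph.graph Sp)

  biadjacencyMatrix : ∀ {k s} → SplitGraph k s → Matrix F k s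
  biadjacencyMatrix {k} {s} Sp i j = A Sp (i ↑ˡ s) (k ↑ʳ j)

{-# OPTIONS --safe #-}

-- Let (x , y) be a null vector of A(Sp), so (J − I)x + Ry = 0 and Rᵗx = 0, and let
-- σ be the sum of the entries of x.  If σ = 0 then x = Ry, hence
-- |x|² = x·Ry = Rᵗx·y = 0 and x = 0.  Thus σ is a functional on the nullspace of
-- A(Sp) whose kernel is 0 ⊕ Null R, and it is nonzero as soon as Supp(Sp) meets K.
module Submission where

open import Defs
import Algebra.Properties.CommutativeSemigroup as CommutativeSemigroupProperties
import Algebra.Properties.Ring as RingProperties
import Algebra.Properties.Semiring.Sum as SemiringSum
open import Data.Bool using (if_then_else_)
open import Data.Fin using (Fin; zero; suc; punchIn; splitAt; join; _↑ˡ_; _↑ʳ_; _≟_)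
open import Data.Fin.Properties using (any?; punchInᵢ≢i; join-splitAt; ↑ˡ-injective)
open import Data.Nat as ℕ using (ℕ; _+_; _≤_)
import Data.Nat.Properties as ℕₚ
open import Data.Product using (∃-syntax; _×_; _,_; proj₁; proj₂)
open import Data.Sum using (_⊎_; inj₁; inj₂; [_,_])
open import Data.Vec.Functional using (Vector; _∷_; _++_; head; tail)
open import Data.Vec.Functional.Properties using (lookup-++ˡ; lookup-++ʳ)
open import Function using (_∘_)
open import Relation.Binary using (IsStrictTotalOrder; tri<; tri≈; tri>)
open import Relation.Binary.PropositionalEquality as ≡ using (_≡_; _≢_)
import Relation.Binary.Reasoning.Setoid as SetoidReasoning
open import Relation.Nullary using (¬_; yes; no; contradiction)
open import Relation.Nullary.Decidable using (does; ¬?; dec-true; dec-false)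
open import Relation.Unary using (Pred; _∩_; Satisfiable)

-- Every index is the `join` of its own `splitAt`, so a property may be checked on the two blocks
-- separately.
↑-elim : ∀ m n {p} (P : Pred (Fin (m + n)) p) →
         (∀ i → P (i ↑ˡ n)) → (∀ j → P (m ↑ʳ j)) → ∀ v → P v
↑-elim m n P l r v =
  ≡.subst P (join-splitAt m n v) ([_,_] {C = P ∘ join m n} l r (splitAt m v))

transpose : ∀ {a m n} {C : Set a} → Vector (Vector C n) m → Vector (Vector C m) n
transpose M j i = M i j

module FieldTheory {c ℓ₁ ℓ₂} (F : OrderedField c ℓ₁ ℓ₂) where
  open OrderedField F hiding (zero) renaming (_+_ to infixl 6 _⊕_)
  open IsStrictTotalOrder isStrictTotalOrder using (compare; irrefl)
    renaming (trans to <-trans; <-respˡ-≈ to <-respˡ; <-respʳ-≈ to <-respʳ)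
  open SemiringSum semiring
  open RingProperties ring
  open CommutativeSemigroupProperties *-commutativeSemigroup using (x∙yz≈y∙xz; x∙yz≈yx∙z)
  open SetoidReasoning setoid
  open LinearAlgebra F

  -- Finite sums and dot products.

  sum-zero : ∀ {n} {f : Vector Carrier n} → (∀ i → f i ≈ 0#) → sum f ≈ 0#
  sum-zero {n} f≈0 = trans (sum-cong-≋ f≈0) (sum-replicate-zero n)

  sum-split : ∀ m {n} (f : Vector Carrier (m + n)) →
              sum f ≈ sum (f ∘ (_↑ˡ n)) ⊕ sum (f ∘ (m ↑ʳ_))
  sum-split ℕ.zero    f = sym (+-identityˡ _)
  sum-split (ℕ.suc m) f = trans (+-congˡ (sum-split m (tail f))) (sym (+-assoc _ _ _))

  sum-linear : ∀ {n} (x y : Vector Carrier n) t →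
               ∑[ j < n ] (x j ⊕ t * y j) ≈ sum x ⊕ t * sum y
  sum-linear x y t =
    trans (∑-distrib-+ x (λ j → t * y j)) (+-congˡ (sym (*-distribˡ-sum t y)))

  dot-linear : ∀ {n} (φ x y : Vector Carrier n) t →
               dot φ (λ j → x j ⊕ t * y j) ≈ dot φ x ⊕ t * dot φ y
  dot-linear {n} φ x y t =
    trans (sum-cong-≋ {n} (λ j → trans (distribˡ _ _ _) (+-congˡ (x∙yz≈y∙xz _ _ _))))
          (sum-linear (λ j → φ j * x j) (λ j → φ j * y j) t)

  dot-zeroˡ : ∀ {n} {φ : Vector Carrier n} → (∀ j → φ j ≈ 0#) → ∀ x → dot φ x ≈ 0#
  dot-zeroˡ φ≈0 x = sum-zero (λ j → trans (*-congʳ (φ≈0 j)) (zeroˡ (x j)))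

  dot-zeroʳ : ∀ {n} (φ : Vector Carrier n) {x} → (∀ j → x j ≈ 0#) → dot φ x ≈ 0#
  dot-zeroʳ φ x≈0 = sum-zero (λ j → trans (*-congˡ (x≈0 j)) (zeroʳ (φ j)))

  dot-congʳ : ∀ {n} (φ : Vector Carrier n) {x y} → (∀ j → x j ≈ y j) → dot φ x ≈ dot φ y
  dot-congʳ φ x≈y = sum-cong-≋ (λ j → *-congˡ (x≈y j))

  dot-congˡ : ∀ {n} {φ ψ : Vector Carrier n} → (∀ j → φ j ≈ ψ j) → ∀ x → dot φ x ≈ dot ψ x
  dot-congˡ φ≈ψ x = sum-cong-≋ (λ j → *-congʳ (φ≈ψ j))

  -- Exchange of the two finite sums. It serves both for x·Ry = Rᵗx·y and for the coordinate matrix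
  -- in the comparison of two bases.
  dot-adjoint : ∀ {m n} (M : Matrix F m n) x y →
                dot x (λ i → dot (M i) y) ≈ dot (λ j → dot (transpose M j) x) y
  dot-adjoint {m} {n} M x y = begin
    ∑[ i < m ] (x i * ∑[ j < n ] (M i j * y j))
      ≈⟨ sum-cong-≋ (λ i → *-distribˡ-sum (x i) (λ j → M i j * y j)) ⟩
    ∑[ i < m ] ∑[ j < n ] (x i * (M i j * y j))
      ≈⟨ ∑-comm (λ i j → x i * (M i j * y j)) ⟩
    ∑[ j < n ] ∑[ i < m ] (x i * (M i j * y j))
      ≈⟨ sum-cong-≋ (λ j → trans (sum-cong-≋ (λ i → x∙yz≈yx∙z (x i) (M i j) (y j)))
                                 (sym (*-distribʳ-sum (y j) (λ i → M i j * x i)))) ⟩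
    ∑[ j < n ] (∑[ i < m ] (M i j * x i) * y j) ∎

  -- Here `φ` is the row `i` of J - I: adding back the missing diagonal term completes the full sum.
  dot-offDiagonal : ∀ {n} (φ x : Vector Carrier n) i → φ i ≈ 0# →
                    (∀ j → j ≢ i → φ j ≈ 1#) → dot φ x ⊕ x i ≈ sum x
  dot-offDiagonal {ℕ.suc n} φ x i φi≈0 φj≈1 = begin
    dot φ x ⊕ x i
      ≈⟨ +-congʳ (sum-remove {i = i} (λ j → φ j * x j)) ⟩
    φ i * x i ⊕ ∑[ j < n ] (φ (punchIn i j) * x (punchIn i j)) ⊕ x i
      ≈⟨ +-congʳ (+-cong (trans (*-congʳ φi≈0) (zeroˡ _))
           (sum-cong-≋ {n} (λ j → trans (*-congʳ (φj≈1 _ (punchInᵢ≢i i j))) (*-identityˡ _)))) ⟩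
    0# ⊕ ∑[ j < n ] x (punchIn i j) ⊕ x i
      ≈⟨ +-congʳ (+-identityˡ _) ⟩
    ∑[ j < n ] x (punchIn i j) ⊕ x i
      ≈⟨ +-comm _ _ ⟩
    x i ⊕ ∑[ j < n ] x (punchIn i j)
      ≈⟨ sum-remove {i = i} x ⟨
    sum x ∎

  -- Positive definiteness of the dot product.

  -- Trichotomy makes each square zero or positive, and positivity survives addition. This is where
  -- the sign structure of the field enters.
  sum-squares : ∀ {n} (x : Vector Carrier n) → (∀ i → x i ≈ 0#) ⊎ 0# < dot x x
  sum-squares {ℕ.zero}  x = inj₁ λ ()
  sum-squares {ℕ.suc n} x with square (head x) | sum-squares (tail x)
    where
    square : ∀ a → a ≈ 0# ⊎ 0# < a * a
    square a with compare a 0#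
    ... | tri≈ _ a≈0 _ = inj₁ a≈0
    ... | tri> _ _ 0<a = inj₂ (*-pos 0<a 0<a)
    ... | tri< a<0 _ _ = inj₂ (<-respʳ -a*-a≈a*a (*-pos 0<-a 0<-a))
      where
      0<-a : 0# < - a
      0<-a = <-respˡ (-‿inverseʳ a) (<-respʳ (+-identityˡ _) (+-monoˡ-< (- a) a<0))

      -a*-a≈a*a : - a * - a ≈ a * a
      -a*-a≈a*a = trans (sym (-‿distribˡ-* a (- a)))
                        (trans (-‿cong (sym (-‿distribʳ-* a a))) (-‿involutive (a * a)))
  ... | inj₁ x₀≈0 | inj₁ xs≈0 = inj₁ λ { zero → x₀≈0 ; (suc i) → xs≈0 i }
  ... | inj₁ x₀≈0 | inj₂ 0<xs = inj₂ (<-respʳ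
          (sym (trans (+-congʳ (trans (*-congʳ x₀≈0) (zeroˡ _))) (+-identityˡ _))) 0<xs)
  ... | inj₂ 0<x₀ | inj₁ xs≈0 = inj₂ (<-respʳ
          (sym (trans (+-congˡ (dot-zeroʳ (tail x) xs≈0)) (+-identityʳ _))) 0<x₀)
  ... | inj₂ 0<x₀ | inj₂ 0<xs = inj₂ (<-trans 0<xs
          (<-respˡ (+-identityˡ _) (+-monoˡ-< _ 0<x₀)))

  dot-definite : ∀ {n} (x : Vector Carrier n) → dot x x ≈ 0# → ∀ i → x i ≈ 0#
  dot-definite x x·x≈0 with sum-squares x
  ... | inj₁ x≈0 = x≈0
  ... | inj₂ 0<x·x = contradiction 0<x·x (irrefl (sym x·x≈0))

  -- Dimension and its uniqueness.

  -- The elimination computing nl drops at most one basis vector per row.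
  n≤m+nl : ∀ {m n} (M : Matrix F m n) → n ≤ m + nl F M
  n≤m+nl {ℕ.zero}  M = ℕₚ.≤-refl
  n≤m+nl {ℕ.suc m} M with nullspace-dimension (tail M) | n≤m+nl (tail M)
  ... | d , b , isB | n≤m+d
    with any? (λ i → ¬? (IsStrictTotalOrder._≟_ isStrictTotalOrder (dot (head M) (b i)) 0#))
  ... | no _ = ℕₚ.m≤n⇒m≤1+n n≤m+d
  n≤m+nl {ℕ.suc m} M | ℕ.suc d , b , isB | n≤m+d | yes _ =
    ℕₚ.≤-trans n≤m+d (ℕₚ.≤-reflexive (ℕₚ.+-suc m d))

  -- If `b i` vanished, the unit coefficient vector `e` at `i` would be a linear relation, and
  -- independence would force 1 = 0.
  basis-nonzero : ∀ {d n} {V : Pred (Vector Carrier n) ℓ₁} {b : Vector (Vector Carrier n) d} →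
                  IsBasis V b → ∀ i → ¬ (∀ j → b i j ≈ 0#)
  basis-nonzero {d} {b = b} isB i bi≈0 = 0≉1 (sym (trans (sym (reflexive e-diag))
    (IsBasis.independent isB e (λ j → sum-zero (e·b≈0 j)) i)))
    where
    e : Vector Carrier d
    e k = if does (k ≟ i) then 1# else 0#

    e-diag : e i ≡ 1#
    e-diag = ≡.cong (if_then 1# else 0#) (dec-true (i ≟ i) ≡.refl)

    e·b≈0 : ∀ j k → e k * b k j ≈ 0#
    e·b≈0 j k with k ≟ i
    ... | yes ≡.refl = trans (*-congˡ (bi≈0 j)) (zeroʳ _)
    ... | no _       = zeroˡ _

  -- Since n ≤ m + nl and m < n, the computed basis is nonempty; its first vector is the witness.
  underdetermined : ∀ {m n} (M : Matrix F m n) → m ℕ.< n →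
                    ∃[ x ] Nullspace M x × ¬ (∀ i → x i ≈ 0#)
  underdetermined {m} M m<n with nullspace-dimension M | n≤m+nl M
  ... | ℕ.zero  , _ , _   | n≤m+0 =
    contradiction (ℕₚ.≤-trans n≤m+0 (ℕₚ.≤-reflexive (ℕₚ.+-identityʳ m))) (ℕₚ.<⇒≱ m<n)
  ... | ℕ.suc _ , b , isB | _ = b zero , IsBasis.members isB zero , basis-nonzero isB zero

  module _ {n} {V : Pred (Vector Carrier n) ℓ₁} where

    -- The rows of `C` are the coordinates of the `b i` with respect to `b′`. If e < d, the
    -- transpose of `C` has a nonzero null vector `a`, which is then a linear relation among the
    -- `b i`.
    dimension-≤ : ∀ {d e} → HasDimension V d → HasDimension V e → d ≤ e
    dimension-≤ {d} {e} (b , isB) (b′ , isB′) = ℕₚ.≮⇒≥ λ e<d →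
      let a , C·a≈0 , a≉0 = underdetermined (transpose C) e<d
      in a≉0 (IsBasis.independent isB a λ j → begin
        lincomb a b j
          ≈⟨ dot-congʳ a (λ i → proj₂ (coordinates i) j) ⟨
        dot a (λ i → dot (C i) (λ l → b′ l j))
          ≈⟨ dot-adjoint C a (λ l → b′ l j) ⟩
        dot (λ l → dot (transpose C l) a) (λ l → b′ l j)
          ≈⟨ dot-zeroˡ C·a≈0 (λ l → b′ l j) ⟩
        0# ∎)
      where
      coordinates = λ i → IsBasis.spanning isB′ (b i) (IsBasis.members isB i)

      C : Matrix F d e
      C i = proj₁ (coordinates i)

    -- Lets `nl`, defined through one particular elimination, be read off from any explicit basis.
    dimension-unique : ∀ {d e} → HasDimension V d → HasDimension V e → d ≡ e
    dimension-unique D E = ℕₚ.≤-antisym (dimension-≤ D E) (dimension-≤ E D)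

  -- The block structure of A(Sp).

  module Split {k s} (Sp : SplitGraph k s) where
    open SplitGraph Sp using (graph; K-clique; S-independent)
    open Graph graph

    B : Matrix F (k + s) (k + s)
    B = A F Sp

    R : Matrix F k s
    R = biadjacencyMatrix F Sp

    adjacent : ∀ {u v} → u ~ v → B u v ≈ 1#
    adjacent {u} {v} u~v = reflexive (≡.cong (if_then 1# else 0#) (dec-true (u ~? v) u~v))

    nonadjacent : ∀ {u v} → ¬ u ~ v → B u v ≈ 0#
    nonadjacent {u} {v} u≁v = reflexive (≡.cong (if_then 1# else 0#) (dec-false (u ~? v) u≁v))

    B-sym : ∀ u v → B u v ≈ B v u
    B-sym u v with u ~? v
    ... | yes u~v = sym (adjacent (~-sym u~v))
    ... | no  u≁v = sym (nonadjacent (u≁v ∘ ~-sym))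

    onK : Vector Carrier (k + s) → Vector Carrier k
    onK x i = x (i ↑ˡ s)

    onS : Vector Carrier (k + s) → Vector Carrier s
    onS x j = x (k ↑ʳ j)

    σ : Vector Carrier (k + s) → Carrier
    σ x = sum (onK x)

    -- The clique block is J - I, so the entry `onK x i` added on the left turns its contribution
    -- into the full sum `σ x`.
    K-row : ∀ x i → dot (B (i ↑ˡ s)) x ⊕ onK x i ≈ σ x ⊕ dot (R i) (onS x)
    K-row x i = begin
      dot (B (i ↑ˡ s)) x ⊕ onK x i
        ≈⟨ +-congʳ (sum-split k _) ⟩
      dot (onK (B (i ↑ˡ s))) (onK x) ⊕ dot (R i) (onS x) ⊕ onK x i
        ≈⟨ +-assoc _ _ _ ⟩
      dot (onK (B (i ↑ˡ s))) (onK x) ⊕ (dot (R i) (onS x) ⊕ onK x i)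
        ≈⟨ +-congˡ (+-comm _ _) ⟩
      dot (onK (B (i ↑ˡ s))) (onK x) ⊕ (onK x i ⊕ dot (R i) (onS x))
        ≈⟨ +-assoc _ _ _ ⟨
      dot (onK (B (i ↑ˡ s))) (onK x) ⊕ onK x i ⊕ dot (R i) (onS x)
        ≈⟨ +-congʳ (dot-offDiagonal _ (onK x) i (nonadjacent (~-irr ≡.refl))
             (λ j j≢i → adjacent (K-clique (i , ≡.refl) (j , ≡.refl)
                (j≢i ∘ ≡.sym ∘ ↑ˡ-injective s i j)))) ⟩
      σ x ⊕ dot (R i) (onS x) ∎

    -- Independence of S kills the lower right block, and symmetry of adjacency identifies the lower
    -- left one with Rᵗ.
    S-row : ∀ x j → dot (B (k ↑ʳ j)) x ≈ dot (transpose R j) (onK x)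
    S-row x j = begin
      dot (B (k ↑ʳ j)) x
        ≈⟨ sum-split k _ ⟩
      dot (onK (B (k ↑ʳ j))) (onK x) ⊕ dot (onS (B (k ↑ʳ j))) (onS x)
        ≈⟨ +-cong (dot-congˡ (λ i → B-sym (k ↑ʳ j) (i ↑ˡ s)) (onK x))
                  (dot-zeroˡ (λ l → nonadjacent (S-independent (j , ≡.refl) (l , ≡.refl))) (onS x)) ⟩
      dot (transpose R j) (onK x) ⊕ 0#
        ≈⟨ +-identityʳ _ ⟩
      dot (transpose R j) (onK x) ∎

    -- Null vectors in the kernel of `σ`.

    σ≈0⇒onK≈R·onS : ∀ x → Nullspace B x → σ x ≈ 0# → ∀ i → onK x i ≈ dot (R i) (onS x)
    σ≈0⇒onK≈R·onS x Bx≈0 σ≈0 i = begin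
      onK x i                        ≈⟨ +-identityˡ _ ⟨
      0# ⊕ onK x i                   ≈⟨ +-congʳ (Bx≈0 (i ↑ˡ s)) ⟨
      dot (B (i ↑ˡ s)) x ⊕ onK x i   ≈⟨ K-row x i ⟩
      σ x ⊕ dot (R i) (onS x)        ≈⟨ +-congʳ σ≈0 ⟩
      0# ⊕ dot (R i) (onS x)         ≈⟨ +-identityˡ _ ⟩
      dot (R i) (onS x)              ∎

    σ≈0⇒onK≈0 : ∀ x → Nullspace B x → σ x ≈ 0# → ∀ i → onK x i ≈ 0#
    σ≈0⇒onK≈0 x Bx≈0 σ≈0 = dot-definite (onK x) (begin
      dot (onK x) (onK x)
        ≈⟨ dot-congʳ (onK x) (σ≈0⇒onK≈R·onS x Bx≈0 σ≈0) ⟩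
      dot (onK x) (λ i → dot (R i) (onS x))
        ≈⟨ dot-adjoint R (onK x) (onS x) ⟩
      dot (λ j → dot (transpose R j) (onK x)) (onS x)
        -- The S-rows of the null equation say that Rᵗ annihilates `onK x`.
        ≈⟨ dot-zeroˡ (λ j → trans (sym (S-row x j)) (Bx≈0 (k ↑ʳ j))) (onS x) ⟩
      0# ∎)

    σ≈0⇒onS∈NullR : ∀ x → Nullspace B x → σ x ≈ 0# → Nullspace R (onS x)
    σ≈0⇒onS∈NullR x Bx≈0 σ≈0 i =
      trans (sym (σ≈0⇒onK≈R·onS x Bx≈0 σ≈0 i)) (σ≈0⇒onK≈0 x Bx≈0 σ≈0 i)

    -- Embedding Null R into the nullspace of A(Sp).

    extend : Vector Carrier s → Vector Carrier (k + s)
    extend y = (λ _ → 0#) ++ y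

    onK-extend : ∀ y i → onK (extend y) i ≈ 0#
    onK-extend y i = reflexive (lookup-++ˡ (λ _ → 0#) y i)

    onS-extend : ∀ y j → onS (extend y) j ≈ y j
    onS-extend y j = reflexive (lookup-++ʳ {m = k} (λ _ → 0#) y j)

    -- With zero K-part both `σ` and the Rᵗ term vanish, so only `R y` is left to be zero.
    extend-null : ∀ y → Nullspace R y → Nullspace B (extend y)
    extend-null y Ry≈0 = ↑-elim k s (λ v → dot (B v) (extend y) ≈ 0#)
      (λ i → begin
        dot (B (i ↑ˡ s)) (extend y)
          ≈⟨ +-identityʳ _ ⟨
        dot (B (i ↑ˡ s)) (extend y) ⊕ 0#
          ≈⟨ +-congˡ (onK-extend y i) ⟨
        dot (B (i ↑ˡ s)) (extend y) ⊕ onK (extend y) i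
          ≈⟨ K-row (extend y) i ⟩
        σ (extend y) ⊕ dot (R i) (onS (extend y))
          ≈⟨ +-cong (sum-zero (onK-extend y))
                    (trans (dot-congʳ (R i) (onS-extend y)) (Ry≈0 i)) ⟩
        0# ⊕ 0#
          ≈⟨ +-identityʳ 0# ⟩
        0# ∎)
      (λ j → trans (S-row (extend y) j) (dot-zeroʳ (transpose R j) (onK-extend y)))

    onK-lincomb : ∀ {d} a (b : Vector (Vector Carrier s) d) i →
                  lincomb a (extend ∘ b) (i ↑ˡ s) ≈ 0#
    onK-lincomb a b i = dot-zeroʳ a (λ l → onK-extend (b l) i)

    onS-lincomb : ∀ {d} a (b : Vector (Vector Carrier s) d) j →
                  lincomb a (extend ∘ b) (k ↑ʳ j) ≈ lincomb a b j
    onS-lincomb a b j = dot-congʳ a (λ l → onS-extend (b l) j)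

    -- A basis of Null A(Sp) from a null vector `z` that is nonzero on K.

    module _ (z : Vector Carrier (k + s)) (Bz≈0 : Nullspace B z)
             (v : Fin k) (zᵥ≉0 : ¬ onK z v ≈ 0#) where

      σz⁻¹ : ∃[ q ] σ z * q ≈ 1#
      σz⁻¹ = inverse (σ z) λ σ≈0 → zᵥ≉0 (σ≈0⇒onK≈0 z Bz≈0 σ≈0 v)

      module _ {d} {b : Vector (Vector Carrier s) d} (isB : IsBasis (Nullspace R) b) where
        open IsBasis isB

        -- One vector outside the kernel of `σ`, followed by the image of a basis of Null R, which
        -- spans that kernel within Null A(Sp).
        z∷b : Vector (Vector Carrier (k + s)) (ℕ.suc d)
        z∷b = z ∷ extend ∘ b

        members′ : ∀ i → Nullspace B (z∷b i)
        members′ zero    = Bz≈0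
        members′ (suc i) = extend-null (b i) (members i)

        -- The extended vectors vanish on K, so the coordinate `v` isolates the coefficient of `z`.
        -- Once that is zero, the S-coordinates give a relation among the `b i`.
        independent′ : ∀ a → (∀ j → lincomb a z∷b j ≈ 0#) → ∀ i → a i ≈ 0#
        independent′ a a·z∷b≈0 = λ { zero → a₀≈0 ; (suc i) → independent (tail a) tail·b≈0 i }
          where
          a₀zᵥ≈0 : a zero * onK z v ≈ 0#
          a₀zᵥ≈0 = trans (sym (trans (+-congˡ (onK-lincomb (tail a) b v)) (+-identityʳ _)))
                         (a·z∷b≈0 (v ↑ˡ s))

          a₀≈0 : a zero ≈ 0#
          a₀≈0 = let q , zᵥq≈1 = inverse _ zᵥ≉0 in begin
            a zero                  ≈⟨ *-identityʳ _ ⟨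
            a zero * 1#             ≈⟨ *-congˡ zᵥq≈1 ⟨
            a zero * (onK z v * q)  ≈⟨ *-assoc _ _ _ ⟨
            a zero * onK z v * q    ≈⟨ *-congʳ a₀zᵥ≈0 ⟩
            0# * q                  ≈⟨ zeroˡ q ⟩
            0#                      ∎

          tail·b≈0 : ∀ j → lincomb (tail a) b j ≈ 0#
          tail·b≈0 j = begin
            lincomb (tail a) b j
              ≈⟨ onS-lincomb (tail a) b j ⟨
            lincomb (tail a) (extend ∘ b) (k ↑ʳ j)
              ≈⟨ +-identityˡ _ ⟨
            0# ⊕ lincomb (tail a) (extend ∘ b) (k ↑ʳ j)
              ≈⟨ +-congʳ (trans (*-congʳ a₀≈0) (zeroˡ _)) ⟨
            lincomb a z∷b (k ↑ʳ j)
              ≈⟨ a·z∷b≈0 (k ↑ʳ j) ⟩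
            0# ∎

        spanning′ : ∀ x → Nullspace B x → ∃[ a ] (∀ j → lincomb a z∷b j ≈ x j)
        spanning′ x Bx≈0 = u ∷ a , λ j → begin
          u * z j ⊕ lincomb a (extend ∘ b) j  ≈⟨ +-congˡ (a·b≈w j) ⟩
          u * z j ⊕ (x j ⊕ - u * z j)         ≈⟨ +-congˡ (+-congˡ (-‿distribˡ-* u (z j))) ⟨
          u * z j ⊕ (x j ⊕ - (u * z j))       ≈⟨ +-assoc _ _ _ ⟨
          u * z j ⊕ x j ⊕ - (u * z j)         ≈⟨ xyx⁻¹≈y (u * z j) (x j) ⟩
          x j                                 ∎
          where
          q = proj₁ σz⁻¹
          -- This is σ(x)/σ(z), the one multiple of `z` whose removal from `x` leaves a vector `w`
          -- with σ(w) = 0; then `w` comes from Null R.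
          u = σ x * q

          w : Vector Carrier (k + s)
          w j = x j ⊕ - u * z j

          u*σz≈σx : u * σ z ≈ σ x
          u*σz≈σx = trans (*-assoc _ _ _)
            (trans (*-congˡ (trans (*-comm q (σ z)) (proj₂ σz⁻¹))) (*-identityʳ (σ x)))

          σw≈0 : σ w ≈ 0#
          σw≈0 = begin
            σ w                 ≈⟨ sum-linear (onK x) (onK z) (- u) ⟩
            σ x ⊕ - u * σ z     ≈⟨ +-congˡ (-‿distribˡ-* u (σ z)) ⟨
            σ x ⊕ - (u * σ z)   ≈⟨ +-congˡ (-‿cong u*σz≈σx) ⟩
            σ x ⊕ - σ x         ≈⟨ -‿inverseʳ (σ x) ⟩
            0#                  ∎

          Bw≈0 : Nullspace B w
          Bw≈0 i = begin
            dot (B i) w                      ≈⟨ dot-linear (B i) x z (- u) ⟩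
            dot (B i) x ⊕ - u * dot (B i) z  ≈⟨ +-cong (Bx≈0 i) (trans (*-congˡ (Bz≈0 i)) (zeroʳ _)) ⟩
            0# ⊕ 0#                          ≈⟨ +-identityʳ 0# ⟩
            0#                               ∎

          onS-w = spanning (onS w) (σ≈0⇒onS∈NullR w Bw≈0 σw≈0)
          a = proj₁ onS-w

          a·b≈w : ∀ j → lincomb a (extend ∘ b) j ≈ w j
          a·b≈w = ↑-elim k s (λ j → lincomb a (extend ∘ b) j ≈ w j)
            (λ i → trans (onK-lincomb a b i) (sym (σ≈0⇒onK≈0 w Bw≈0 σw≈0 i)))
            (λ j → trans (onS-lincomb a b j) (proj₂ onS-w j))

        z∷b-isBasis : IsBasis (Nullspace B) z∷b
        z∷b-isBasis = record
          { members = members′ ; independent = independent′ ; spanning = spanning′ }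

theorem5p3 : ∀ {c ℓ₁ ℓ₂} (F : OrderedField c ℓ₁ ℓ₂) (k s : ℕ) (Sp : SplitGraph k s) →
    Satisfiable (Supp F (A F Sp) ∩ SplitGraph.K Sp) →
    nl F (A F Sp) ≡ nl F (biadjacencyMatrix F Sp) + 1
-- Matching on `≡.refl` places the support vertex at `v ↑ˡ s`, so that `zᵥ≉0` speaks of `onK z v`.
theorem5p3 F k s Sp (_ , (z , Az≈0 , zᵥ≉0) , v , ≡.refl) =
  let d , b , isB = nullspace-dimension R
  in ≡.trans
       (dimension-unique (proj₂ (nullspace-dimension B)) (_ , z∷b-isBasis z Az≈0 v zᵥ≉0 isB))
       -- The vector `z` is put in front, which gives length 1 + d rather than d + 1.
       (ℕₚ.+-comm 1 d)
  where
  open LinearAlgebra F using (nullspace-dimension)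
  open FieldTheory F
  open Split Sp
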